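{- Let $(\tau_\Sigma,\mathbb{B}_\Sigma)_\Sigma$ be a family indexed by the finite sets $\Sigma$ with at least two elements, where $\tau_\Sigma$ is a topology on $\Sigma^{\mathbb{N}}$ and $\mathbb{B}_\Sigma$ is a basis of $\tau_\Sigma$, satisfying: (P1) $\mathbb{B}_\Sigma$ contains every set $N_w$, $w\in\Sigma^*$; (P2) $\mathbb{B}_\Sigma$ is closed under finite unions and finite intersections; (P3) if $\Gamma$ is a finite set with at least two elements and $L\in\mathbb{B}_{\Sigma\times\Gamma}$, then $\pi_0[L]\in\mathbb{B}_\Sigma$; (P4) for each $L\in\mathbb{B}_\Sigma$ there is $C\in\mathbb{B}_{\Sigma\times 2}$ with $C\subseteq\Sigma^{\mathbb{N}}\times\mathbb{P}_\infty$, $C$ closed in $\Sigma^{\mathbb{N}}\times\mathbb{P}_\infty$ (i.e. $C=F\cap(\Sigma^{\mathbb{N}}\times\mathbb{P}_\infty)$ for some $\tau_C$-closed $F\subseteq\Sigma^{\mathbb{N}}\times 2^{\mathbb{N}}$), and $L=\pi_0[C]$. Then every topology $\tau_\Sigma$ is strong Choquet.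
   Context: $N_w=\{\sigma\in\Sigma^{\mathbb{N}}: w\text{ prefix of }\sigma\}$; $\tau_C$ denotes the product-of-discrete (Cantor) topology. $2=\{0,1\}$ and $\mathbb{P}_\infty=\{\alpha\in 2^{\mathbb{N}}: \alpha(i)=1\text{ for infinitely many } i\}$. The space $\Sigma^{\mathbb{N}}\times\Gamma^{\mathbb{N}}$ is identified with $(\Sigma\times\Gamma)^{\mathbb{N}}$ via $(\sigma,\gamma)\mapsto((\sigma(n),\gamma(n)))_n$, and $\pi_0$ is the projection onto the first coordinate. Strong Choquet game on a space $X$: Player 1 plays an open $U_i$ and $x_i\in U_i$ with $U_i\subseteq V_{i-1}$; Player 2 plays an open $V_i$ with $x_i\in V_i\subseteq U_i$; Player 2 wins if $\bigcap_i V_i\neq\emptyset$. $X$ is strong Choquet if it is nonempty and Player 2 has a winning strategy. -}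

module Defs where

open import Level using (Level; 0ℓ; _⊔_) renaming (suc to lsuc)
open import Data.Fin using (Fin; toℕ; inject≤)
open import Data.Fin.Patterns using (1F)
open import Data.Fin.Properties using (toℕ-inject≤; *↔×)
open import Data.List using (List; []; length; lookup)
open import Data.Nat using (ℕ; suc; _≤_; _*_; z≤n; s≤s)
open import Data.Nat.Properties using (≤-total; ≤-refl; ≤-trans; *-mono-≤)
open import Data.Product using (Σ-syntax; ∃-syntax; _×_; _,_; proj₂; <_,_>)
open import Data.Product.Function.NonDependent.Propositional using (_×-↔_)
open import Data.Sum using (inj₁; inj₂)
open import Function using (_∘_; _↔_; _⇔_)
open import Function.Properties.Inverse using (↔-refl; ↔-sym; ↔-trans)
open import Relation.Binary.Definitions using (_Respects_)
open import Relation.Binary.PropositionalEquality using (_≡_; refl; sym; trans)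
open import Relation.Nullary using (Irrelevant)
open import Relation.Unary using (Pred; _∈_; _⊆_; _≐_; ∅; U; ∁; _∩_; ⋃)

Subset : Set → Set₁
Subset X = Pred X 0ℓ

record Topology (X : Set) (a : Level) : Set (lsuc (0ℓ ⊔ a)) where
  field
    Open      : Pred (Subset X) a
    open-resp : Open Respects _≐_
    open-∅    : Open ∅
    open-U    : Open U
    open-∩    : ∀ {P Q} → Open P → Open Q → Open (P ∩ Q)
    open-⋃    : ∀ (I : Set) (P : I → Subset X) → (∀ i → Open (P i)) → Open (⋃ I P)

  Closed : Pred (Subset X) (lsuc 0ℓ ⊔ a)
  Closed F = ∃[ P ] Open P × F ≐ ∁ P

open Topology using (Open; Closed) public

record IsBasis {X : Set} {a b : Level} (τ : Topology X a)
               (𝔹 : Pred (Subset X) b) : Set (lsuc 0ℓ ⊔ a ⊔ b) where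
  field
    basis-resp   : 𝔹 Respects _≐_
    basis-open   : 𝔹 ⊆ Open τ
    basis-covers : ∀ {P} → Open τ P →
                   Σ[ I ∈ Set ] Σ[ B ∈ (I → Subset X) ] (∀ i → B i ∈ 𝔹) × P ≐ ⋃ I B

module Choquet {X : Set} {a : Level} (τ : Topology X a) where

  -- A move is bundled with the evidence that it is legal, so that
  -- positions and runs are legal by construction.  Existential evidence is
  -- data here, so answering from it plays the role of the choices that are
  -- made classically when a strategy is defined.

  record Move (V₋ : Subset X) : Set (lsuc 0ℓ ⊔ a) where
    field
      set     : Subset X
      is-open : Open τ set
      point   : X
      point∈  : point ∈ set
      set⊆    : set ⊆ V₋

  record Reply {V₋ : Subset X} (m : Move V₋) : Set (lsuc 0ℓ ⊔ a) where
    field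
      set     : Subset X
      is-open : Open τ set
      point∈  : Move.point m ∈ set
      set⊆    : set ⊆ Move.set m

  -- Positions in which Player 1 is to move; current p is the last set
  -- played by Player 2, and the whole space before the first round.

  data Position : Set (lsuc 0ℓ ⊔ a)
  current : Position → Subset X

  data Position where
    start : Position
    round : (p : Position) (m : Move (current p)) (r : Reply m) → Position

  current start         = U
  current (round p m r) = Reply.set r

  data _⋖_ (p : Position) : Position → Set (lsuc 0ℓ ⊔ a) where
    next : (m : Move (current p)) (r : Reply m) → p ⋖ round p m r

  record Run : Set (lsuc 0ℓ ⊔ a) where
    field
      position : ℕ → Position
      starts   : position 0 ≡ start
      proceeds : ∀ n → position n ⋖ position (suc n)

  -- Since current start is the whole space, including it does not change
  -- the intersection of the sets played by Player 2.

  Player2Wins : Run → Set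
  Player2Wins R = ∃[ x ] ∀ n → x ∈ current (Run.position R n)

  -- A strategy of Player 2 answers every move of Player 1 in every
  -- position that is compatible with the strategy itself.  As Compatible
  -- is a mere proposition, the answer depends on the position and the
  -- move only.

  record Strategy : Set (lsuc (lsuc 0ℓ ⊔ a)) where
    field
      Compatible : Pred Position (lsuc 0ℓ ⊔ a)
      irrelevant : ∀ {p} → Irrelevant (Compatible p)
      reply      : ∀ {p} → Compatible p → (m : Move (current p)) → Reply m
      compatible-start : Compatible start
      compatible-round : ∀ {p m r} →
        Compatible (round p m r) ⇔ (Σ[ c ∈ Compatible p ] r ≡ reply c m)

  Winning : Strategy → Set (lsuc 0ℓ ⊔ a)
  Winning s = (R : Run) → (∀ n → Strategy.Compatible s (Run.position R n)) →
              Player2Wins R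

StrongChoquet : {X : Set} {a : Level} → Topology X a → Set (lsuc (lsuc 0ℓ ⊔ a))
StrongChoquet {X} τ = X × (Σ[ s ∈ Strategy ] Winning s)
  where open Choquet τ

infix 25 _^ω

_^ω : Set → Set
A ^ω = ℕ → A

N : {A : Set} → List A → Subset (A ^ω)
N w σ = ∀ (i : Fin (length w)) → σ (toℕ i) ≡ lookup w i

private
  N-mono : ∀ {A : Set} (σ : A ^ω) (v w : List A) →
           σ ∈ N v → σ ∈ N w → length v ≤ length w → ∀ ρ → ρ ∈ N w → ρ ∈ N v
  N-mono σ v w σ∈v σ∈w v≤w ρ ρ∈w i =
    trans (agree (toℕ i) (inject≤ i v≤w) (toℕ-inject≤ i v≤w)) (σ∈v i)
    where
    agree : ∀ n (j : Fin (length w)) → toℕ j ≡ n → ρ n ≡ σ n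
    agree _ j refl = trans (ρ∈w j) (sym (σ∈w j))

τ-C : (A : Set) → Topology (A ^ω) 0ℓ
τ-C A = record
  { Open      = λ P → ∀ {σ} → σ ∈ P → ∃[ w ] σ ∈ N w × N w ⊆ P
  ; open-resp = λ { (P⊆Q , Q⊆P) oP σ∈Q →
                    let (w , σ∈w , w⊆P) = oP (Q⊆P σ∈Q) in w , σ∈w , λ ρ∈w → P⊆Q (w⊆P ρ∈w) }
  ; open-∅    = λ ()
  ; open-U    = λ _ → [] , (λ ()) , _
  ; open-∩    = λ oP oQ {σ} (σ∈P , σ∈Q) → inter σ (oP σ∈P) (oQ σ∈Q)
  ; open-⋃    = λ I P oP (i , σ∈Pi) →
                  let (w , σ∈w , w⊆P) = oP i σ∈Pi in w , σ∈w , λ ρ∈w → i , w⊆P ρ∈w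
  }
  where
  inter : ∀ {P Q : Subset (A ^ω)} (σ : A ^ω) →
          (∃[ v ] σ ∈ N v × N v ⊆ P) → (∃[ w ] σ ∈ N w × N w ⊆ Q) →
          ∃[ u ] σ ∈ N u × N u ⊆ P ∩ Q
  inter σ (v , σ∈v , v⊆P) (w , σ∈w , w⊆Q) with ≤-total (length v) (length w)
  ... | inj₁ v≤w = w , σ∈w , λ {ρ} ρ∈w → v⊆P (N-mono σ v w σ∈v σ∈w v≤w ρ ρ∈w) , w⊆Q ρ∈w
  ... | inj₂ w≤v = v , σ∈v , λ {ρ} ρ∈v → v⊆P ρ∈v , w⊆Q (N-mono σ w v σ∈w σ∈v w≤v ρ ρ∈v)

-- A pair (σ , γ) of words is identified with the word < σ , γ > of pairs.

π₀[_] : {A B : Set} → Subset ((A × B) ^ω) → Subset (A ^ω)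
π₀[ L ] σ = ∃[ γ ] < σ , γ > ∈ L

ℙ∞ : Subset (Fin 2 ^ω)
ℙ∞ α = ∀ n → ∃[ i ] n ≤ i × α i ≡ 1F

_^ω×ℙ∞ : (A : Set) → Subset ((A × Fin 2) ^ω)
(A ^ω×ℙ∞) δ = proj₂ ∘ δ ∈ ℙ∞

record IsAlphabet (A : Set) : Set where
  field
    size   : ℕ
    2≤size : 2 ≤ size
    enum   : A ↔ Fin size

open IsAlphabet

two : IsAlphabet (Fin 2)
two = record { size = 2 ; 2≤size = ≤-refl ; enum = ↔-refl }

infixr 2 _⊗_

_⊗_ : {A B : Set} → IsAlphabet A → IsAlphabet B → IsAlphabet (A × B)
𝒜 ⊗ ℬ = record
  { size   = size 𝒜 * size ℬ
  ; 2≤size = ≤-trans (s≤s (s≤s z≤n)) (*-mono-≤ (2≤size 𝒜) (2≤size ℬ))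
  ; enum   = ↔-trans (enum 𝒜 ×-↔ enum ℬ) (↔-sym *↔×)
  }

-- Irrelevance makes the topology and the basis depend on the set A only,
-- not on the chosen enumeration of A.

record TopologyFamily (a b : Level) : Set (lsuc (lsuc 0ℓ ⊔ a ⊔ b)) where
  field
    τ       : {A : Set} → .(IsAlphabet A) → Topology (A ^ω) a
    𝔹       : {A : Set} → .(IsAlphabet A) → Pred (Subset (A ^ω)) b
    isBasis : {A : Set} (𝒜 : IsAlphabet A) → IsBasis (τ 𝒜) (𝔹 𝒜)

{-# OPTIONS --safe #-}

-- Player 2 keeps, for every round i so far, a set C i ⊆ Σ^ω × ℙ∞ as in (P4)
-- with point i ∈ π₀[C i] ⊆ U i, and a finite prefix of a point of C i above the
-- last point played.  The reply is the set of all x that extend, for every i, to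
-- a point of C i with the chosen prefix; it is basic by (P1)–(P3).  In each round
-- every prefix is lengthened so as to contain a further 1 in its second
-- coordinate.  The prefixes of index i then converge to an element of
-- Σ^ω × ℙ∞, which belongs to C i because C i is closed there, and all these
-- limits have the same first coordinate, which therefore lies in every U i.

module Submission where

open import Defs
open import Level using (Level; 0ℓ; _⊔_) renaming (suc to lsuc)
open import Axiom.UniquenessOfIdentityProofs.WithK using (uip)
open import Data.Fin using (Fin; zero; suc; fromℕ<)
open import Data.Fin.Patterns using (0F; 1F)
open import Data.Fin.Properties using (toℕ-fromℕ<; toℕ<n)
open import Data.List using (List; length; applyUpTo)
open import Data.List.Properties using (length-applyUpTo; lookup-applyUpTo)
open import Data.Nat using (ℕ; zero; suc; _+_; _≤_; _<_; z≤n; s≤s; _≤′_; ≤′-refl; ≤′-step)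
open import Data.Nat.Properties
  using (≤-refl; ≤-trans; ≤-total; <⇒≤; ≤⇒≤′; <-≤-trans; ≤-<-trans; m≤m+n; +-identityʳ)
open import Data.Product using (Σ-syntax; ∃-syntax; _×_; _,_; proj₁; proj₂; <_,_>)
open import Data.Sum using (inj₁; inj₂)
open import Data.Unit.Polymorphic using (⊤; tt)
open import Function using (_∘_; id; mk⇔; Inverse)
open import Relation.Binary.PropositionalEquality
  using (_≡_; refl; sym; trans; cong; cong₂; subst)
open import Relation.Nullary using (Irrelevant)
open import Relation.Unary using (Pred; _∈_; _⊆_; _≐_; _∩_; ⋃; ⋂)

-- Prefix agreement and limits of words.

Agree : {A : Set} → ℕ → A ^ω → A ^ω → Set
Agree n σ ρ = ∀ {m} → m < n → σ m ≡ ρ m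

∈N-prefix : {A : Set} (σ : A ^ω) (n : ℕ) → σ ∈ N (applyUpTo σ n)
∈N-prefix σ n i = sym (lookup-applyUpTo σ n i)

N-prefix⇒Agree : {A : Set} {σ ρ : A ^ω} (n : ℕ) → ρ ∈ N (applyUpTo σ n) → Agree n ρ σ
N-prefix⇒Agree {σ = σ} {ρ} n ρ∈ {m} m<n =
  subst (λ t → ρ t ≡ σ t) (toℕ-fromℕ< m<l) (trans (ρ∈ i) (lookup-applyUpTo σ n i))
  where
  m<l : m < length (applyUpTo σ n)
  m<l = subst (m <_) (sym (length-applyUpTo σ n)) m<n
  i : Fin (length (applyUpTo σ n))
  i = fromℕ< m<l

Approximable : {A : Set} → Subset (A ^ω) → Subset (A ^ω)
Approximable C ε = ∀ n → ∃[ δ ] δ ∈ C × Agree n δ ε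

-- If `ε` were in the open complement, so would be every word sharing some finite prefix with it,
-- including an approximant from `F`.
closed⇒complete : {A : Set} {F : Subset (A ^ω)} → Closed (τ-C A) F → Approximable F ⊆ F
closed⇒complete (P , oP , F⊆∁P , ∁P⊆F) {ε} approx = ∁P⊆F λ ε∈P →
  let (w , ε∈w , w⊆P) = oP ε∈P
      (δ , δ∈F , δ≈ε) = approx (length w)
  in F⊆∁P δ∈F (w⊆P λ i → trans (δ≈ε (toℕ<n i)) (ε∈w i))

module Limit {A : Set} (σ : ℕ → A ^ω) (k : ℕ → ℕ)
             (k-mono  : ∀ n → k n < k (suc n))
             (coheres : ∀ n → Agree (k n) (σ (suc n)) (σ n)) where

  n≤k : ∀ n → n ≤ k n
  n≤k zero    = z≤n
  n≤k (suc n) = ≤-trans (s≤s (n≤k n)) (k-mono n)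

  -- As `m < suc m ≤ k (suc m)`, entry `m` no longer changes from `σ (suc m)` on.
  lim : A ^ω
  lim m = σ (suc m) m

  private
    k-≤ : ∀ {l n} → l ≤′ n → k l ≤ k n
    k-≤ ≤′-refl           = ≤-refl
    k-≤ (≤′-step {n} l≤n) = ≤-trans (k-≤ l≤n) (<⇒≤ (k-mono n))

    later : ∀ {m l n} → l ≤′ n → m < k l → σ n m ≡ σ l m
    later ≤′-refl           _   = refl
    later (≤′-step {n} l≤n) m<k =
      trans (coheres n (<-≤-trans m<k (k-≤ l≤n))) (later l≤n m<k)

  lim-agree : ∀ n → Agree (k n) lim (σ n)
  lim-agree n {m} m<k with ≤-total (suc m) n
  ... | inj₁ m<n = sym (later (≤⇒≤′ m<n) (n≤k (suc m)))
  ... | inj₂ n≤m = later (≤⇒≤′ n≤m) m<k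

module _ {a b : Level} (T : TopologyFamily a b) where

  open TopologyFamily T

  module Family
    (P1 : ∀ {A} (𝒜 : IsAlphabet A) (w : List A) → N w ∈ 𝔹 𝒜)
    (P2 : ∀ {A} (𝒜 : IsAlphabet A) (n : ℕ) (L : Fin n → Subset (A ^ω)) →
      (∀ i → L i ∈ 𝔹 𝒜) → ⋃ (Fin n) L ∈ 𝔹 𝒜 × ⋂ (Fin n) L ∈ 𝔹 𝒜)
    (P3 : ∀ {A Γ} (𝒜 : IsAlphabet A) (𝒢 : IsAlphabet Γ) (L : Subset ((A × Γ) ^ω)) →
      L ∈ 𝔹 (𝒜 ⊗ 𝒢) → π₀[ L ] ∈ 𝔹 𝒜)
    (P4 : ∀ {A} (𝒜 : IsAlphabet A) (L : Subset (A ^ω)) → L ∈ 𝔹 𝒜 →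
      ∃[ C ] C ∈ 𝔹 (𝒜 ⊗ two) × C ⊆ A ^ω×ℙ∞ ×
        (∃[ F ] Closed (τ-C (A × Fin 2)) F × C ≐ F ∩ A ^ω×ℙ∞) × L ≐ π₀[ C ])
    {A : Set} (𝒜 : IsAlphabet A) where

    open Choquet (τ 𝒜)

    -- Trees and layers of partial lifts.

    record Tree : Set (lsuc 0ℓ ⊔ b) where
      field
        set      : Subset ((A × Fin 2) ^ω)
        basic    : set ∈ 𝔹 (𝒜 ⊗ two)
        infinite : set ⊆ A ^ω×ℙ∞
        -- Closedness relative to `A ^ω×ℙ∞`, in the form of closure under limits.
        complete : ∀ {ε} → ε ∈ A ^ω×ℙ∞ → Approximable set ε → ε ∈ set

    record Layer : Set (lsuc 0ℓ ⊔ b) where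
      field
        tree    : Tree
        branch  : (A × Fin 2) ^ω
        branch∈ : branch ∈ Tree.set tree
        height  : ℕ

      lifts : Subset ((A × Fin 2) ^ω)
      lifts = Tree.set tree ∩ N (applyUpTo branch height)

    open Layer

    nbhd : Layer → Subset (A ^ω)
    nbhd ℓ = π₀[ lifts ℓ ]

    ∩-basic : ∀ {B : Set} (ℬ : IsAlphabet B) {P Q : Subset (B ^ω)} →
              P ∈ 𝔹 ℬ → Q ∈ 𝔹 ℬ → P ∩ Q ∈ 𝔹 ℬ
    ∩-basic ℬ {P} {Q} P∈ Q∈ =
      IsBasis.basis-resp (isBasis ℬ)
        ((λ ∈⋂ → ∈⋂ 0F , ∈⋂ 1F) , λ { (∈P , ∈Q) → λ { 0F → ∈P ; 1F → ∈Q } })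
        (proj₂ (P2 ℬ 2 (λ { 0F → P ; 1F → Q }) λ { 0F → P∈ ; 1F → Q∈ }))

    nbhd-basic : ∀ ℓ → nbhd ℓ ∈ 𝔹 𝒜
    nbhd-basic ℓ = P3 𝒜 two (lifts ℓ)
      (∩-basic (𝒜 ⊗ two) (Tree.basic (tree ℓ)) (P1 (𝒜 ⊗ two) (applyUpTo (branch ℓ) (height ℓ))))

    basic⇒tree : ∀ {L} → L ∈ 𝔹 𝒜 → Σ[ t ∈ Tree ] L ≐ π₀[ Tree.set t ]
    basic⇒tree {L} L∈ =
      let (C , C∈ , C⊆ , (_ , closed , C⊆F , F⊆C) , L≐) = P4 𝒜 L L∈ in
      record
        { set = C ; basic = C∈ ; infinite = C⊆
        ; complete = λ ε∞ approx → F⊆C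
            ( closed⇒complete closed
                (λ n → let (δ , δ∈C , δ≈ε) = approx n in δ , proj₁ (C⊆F δ∈C) , δ≈ε)
            , ε∞ )
        } , L≐

    grow : (t : Tree) {δ : (A × Fin 2) ^ω} → δ ∈ Tree.set t → ℕ → Layer
    grow t {δ} δ∈ n = record
      -- One past the position of a 1 at or beyond `n`, so the prefix includes this 1.
      { tree = t ; branch = δ ; branch∈ = δ∈ ; height = suc (proj₁ (Tree.infinite t δ∈ n)) }

    grow-nbhd : ∀ (t : Tree) {δ} (δ∈ : δ ∈ Tree.set t) n → proj₁ ∘ δ ∈ nbhd (grow t δ∈ n)
    grow-nbhd t {δ} δ∈ n = proj₂ ∘ δ , δ∈ , ∈N-prefix δ _

    refine : (ℓ : Layer) {x : A ^ω} → x ∈ nbhd ℓ → Layer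
    refine ℓ (_ , δ∈ , _) = grow (tree ℓ) δ∈ (height ℓ)

    -- `coheres` makes the prefixes converge; `one` forces strictly growing heights and infinitely
    -- many 1s in the limit.
    record _≺_ (ℓ ℓ′ : Layer) : Set where
      field
        lower   : Tree.set (tree ℓ′) ⊆ Tree.set (tree ℓ)
        coheres : Agree (height ℓ) (branch ℓ′) (branch ℓ)
        one     : ∃[ j ] height ℓ ≤ j × j < height ℓ′ × proj₂ (branch ℓ′ j) ≡ 1F

    ≺-refine : ∀ ℓ {x} (x∈ : x ∈ nbhd ℓ) → ℓ ≺ refine ℓ x∈
    ≺-refine ℓ (_ , δ∈ , δ∈N) = record
      { lower   = id
      ; coheres = N-prefix⇒Agree (height ℓ) δ∈N
      ; one     = let (j , h≤j , one) = Tree.infinite (tree ℓ) δ∈ (height ℓ)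
                  in j , h≤j , ≤-refl , one
      }

    -- The strategy of Player 2.

    record State (V : Subset (A ^ω)) : Set (lsuc 0ℓ ⊔ b) where
      field
        size   : ℕ
        layer  : Fin size → Layer
        within : V ⊆ ⋂ (Fin size) (nbhd ∘ layer)

    open State

    module Advance {V : Subset (A ^ω)} (S : State V) (m : Move V) where
      open Move m

      born : ∃[ t ] ∃[ γ ] < point , γ > ∈ Tree.set t × π₀[ Tree.set t ] ⊆ set
      born =
        let (_ , B , B∈ , U⊆B , B⊆U) = IsBasis.basis-covers (isBasis 𝒜) is-open
            (i , x∈Bi)               = U⊆B point∈
            (t , B⊆t , t⊆B)          = basic⇒tree (B∈ i)
            (γ , γ∈)                 = B⊆t x∈Bi
        in t , γ , γ∈ , λ y∈ → B⊆U (i , t⊆B y∈)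

      layers : Fin (suc (size S)) → Layer
      -- A new layer has no earlier prefix to extend, hence the bound 0.
      layers zero    = let (t , _ , γ∈ , _) = born in grow t γ∈ 0
      layers (suc i) = refine (layer S i) (within S (set⊆ point∈) i)

      point∈layers : point ∈ ⋂ (Fin (suc (size S))) (nbhd ∘ layers)
      point∈layers zero    = let (t , _ , γ∈ , _) = born in grow-nbhd t γ∈ 0
      point∈layers (suc i) =
        let (_ , γ∈ , _) = within S (set⊆ point∈) i
        in grow-nbhd (tree (layer S i)) γ∈ (height (layer S i))

      answer : Reply m
      answer = record
        { set     = ⋂ (Fin (suc (size S))) (nbhd ∘ layers)
        ; is-open = IsBasis.basis-open (isBasis 𝒜)
                      (proj₂ (P2 𝒜 _ (nbhd ∘ layers) (nbhd-basic ∘ layers)))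
        ; point∈  = point∈layers
        -- Layer `zero` was born below Player 1's set, so its neighbourhood alone gives the
        -- inclusion.
        ; set⊆    = λ y∈ → let (γ , γ∈ , _) = y∈ zero ; (_ , _ , _ , t⊆) = born in t⊆ (γ , γ∈)
        }

      after : State (Reply.set answer)
      after = record { layer = layers ; within = id }

    open Advance

    data _⟿_ {V : Subset (A ^ω)} (S : State V) : ∀ {V′} → State V′ → Set (lsuc 0ℓ ⊔ a ⊔ b) where
      advance : (m : Move V) → S ⟿ after S m

    -- Positions do not record layers: `state` recovers them by replaying the answers, which
    -- compatibility certifies, hence the mutual recursion.
    Compatible : Pred Position (lsuc 0ℓ ⊔ a)
    state : ∀ p → Compatible p → State (current p)

    Compatible start         = ⊤
    Compatible (round p m r) = Σ[ c ∈ Compatible p ] r ≡ answer (state p c) m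

    state start         _          = record { size = 0 ; layer = λ () ; within = λ _ () }
    state (round p m _) (c , refl) = after (state p c) m

    Compatible-irrelevant : ∀ p → Irrelevant (Compatible p)
    Compatible-irrelevant start         _       _         = refl
    Compatible-irrelevant (round p m r) (c , e) (c′ , e′)
      with refl ← Compatible-irrelevant p c c′ = cong (c ,_) (uip e e′)

    strategy : Strategy
    strategy = record
      { Compatible       = Compatible
      ; irrelevant       = λ {p} → Compatible-irrelevant p
      ; reply            = λ {p} c → answer (state p c)
      ; compatible-start = tt
      ; compatible-round = mk⇔ id id
      }

    state-⟿ : ∀ {p q} → p ⋖ q → (c : Compatible p) (d : Compatible q) → state p c ⟿ state q d
    state-⟿ {p} (next m _) c (c′ , refl)
      -- The evidence for `q` carries its own `c′` for `p`, which must first be identified with `c`.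
      with refl ← Compatible-irrelevant p c c′ = advance m

    -- The limit of a compatible run.

    module Step {V V′ : Subset (A ^ω)} {S : State V} {S′ : State V′} where

      move : S ⟿ S′ → Move V
      move (advance m) = m

      new : S ⟿ S′ → Fin (size S′)
      new (advance _) = zero

      old : S ⟿ S′ → Fin (size S) → Fin (size S′)
      old (advance _) = suc

      old-≺ : (s : S ⟿ S′) (i : Fin (size S)) → layer S i ≺ layer S′ (old s i)
      old-≺ (advance m) i = ≺-refine (layer S i) (within S (Move.set⊆ m (Move.point∈ m)) i)

      new-tree⊆ : (s : S ⟿ S′) → π₀[ Tree.set (tree (layer S′ (new s))) ] ⊆ Move.set (move s)
      new-tree⊆ (advance m) = proj₂ (proj₂ (proj₂ (born S m)))

      -- New or refined, each branch was chosen as a lift of the point just played.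
      over-point : (s : S ⟿ S′) (i : Fin (size S′)) →
                   ∀ n → proj₁ (branch (layer S′ i) n) ≡ Move.point (move s) n
      over-point (advance m) zero    n = refl
      over-point (advance m) (suc i) n = refl

    module Play {V : ℕ → Subset (A ^ω)} (S : ∀ n → State (V n)) (step : ∀ n → S n ⟿ S (suc n)) where
      open Step

      point : ℕ → A ^ω
      point n = Move.point (move (step n))

      -- Follows the layer born at move `i` through `j` further rounds; writing `j + i` lets the
      -- types reduce by recursion on `j`.
      module Track (i : ℕ) where

        index : ∀ j → Fin (size (S (suc (j + i))))
        index zero    = new (step i)
        index (suc j) = old (step (suc (j + i))) (index j)

        at : ℕ → Layer
        at j = layer (S (suc (j + i))) (index j)

        at-≺ : ∀ j → at j ≺ at (suc j)
        at-≺ j = old-≺ (step (suc (j + i))) (index j)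

        at-point : ∀ j n → proj₁ (branch (at j) n) ≡ point (j + i) n
        at-point j = over-point (step (j + i)) (index j)

        height-mono : ∀ j → height (at j) < height (at (suc j))
        height-mono j = let (_ , h≤ , <h , _) = _≺_.one (at-≺ j) in ≤-<-trans h≤ <h

        open Limit (branch ∘ at) (height ∘ at) height-mono (_≺_.coheres ∘ at-≺) public

        at-⊆ : ∀ j → Tree.set (tree (at j)) ⊆ Tree.set (tree (at 0))
        at-⊆ zero    = id
        at-⊆ (suc j) = at-⊆ j ∘ _≺_.lower (at-≺ j)

        -- The 1 gained from stage `n` to `suc n` lies at or beyond `n` and below the new height, so
        -- the limit keeps it.
        lim-infinite : proj₂ ∘ lim ∈ ℙ∞
        lim-infinite n =
          let (j , h≤j , j<h , one) = _≺_.one (at-≺ n)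
          in j , ≤-trans (n≤k n) h≤j , trans (cong proj₂ (lim-agree (suc n) j<h)) one

      -- The limit of the points played, read off from the track of the first move.
      x : A ^ω
      x = proj₁ ∘ Track.lim 0

      x-point : ∀ n → Agree n (point n) x
      x-point n {m} m<n = sym (trans
        (cong proj₁ (Track.lim-agree 0 n (<-≤-trans m<n (Track.n≤k 0 n))))
        (trans (Track.at-point 0 n m) (cong (λ t → point t m) (+-identityʳ n))))

      x∈move : ∀ i → x ∈ Move.set (move (step i))
      x∈move i = new-tree⊆ (step i) (proj₂ ∘ lim , Tree.complete (tree (at 0)) lim-infinite
        -- Tracks `0` and `i` are compared through `point (n + i)`: the branch lies over it, and it
        -- agrees with `x` below `n + i`.
        λ n → branch (at n) , at-⊆ n (branch∈ (at n)) , λ {m} m<n → cong₂ _,_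
          (trans (at-point n m) (x-point (n + i) (<-≤-trans m<n (m≤m+n n i))))
          (sym (cong proj₂ (lim-agree n (<-≤-trans m<n (n≤k n))))))
        where open Track i

      x∈all : ∀ n → x ∈ V n
      x∈all n = Move.set⊆ (move (step n)) (x∈move n)

    winning : Winning strategy
    winning R compatible = x , x∈all
      where
      open Run R
      open Play (λ n → state (position n) (compatible n))
                (λ n → state-⟿ (proceeds n) (compatible n) (compatible (suc n)))

    someWord : A ^ω
    -- `2 ≤ size` is read as `1 < size`, which yields a letter.
    someWord _ = Inverse.from enum (fromℕ< 2≤size)
      where open IsAlphabet 𝒜

    strongChoquet : StrongChoquet (τ 𝒜)
    strongChoquet = someWord , strategy , winning

theorem3p1 : {a b : Level} (T : TopologyFamily a b) →
    let open TopologyFamily T in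
    -- (P1)
    (∀ {A} (𝒜 : IsAlphabet A) (w : List A) → N w ∈ 𝔹 𝒜) →
    -- (P2)
    (∀ {A} (𝒜 : IsAlphabet A) (n : ℕ) (L : Fin n → Subset (A ^ω)) →
      (∀ i → L i ∈ 𝔹 𝒜) → ⋃ (Fin n) L ∈ 𝔹 𝒜 × ⋂ (Fin n) L ∈ 𝔹 𝒜) →
    -- (P3)
    (∀ {A Γ} (𝒜 : IsAlphabet A) (𝒢 : IsAlphabet Γ) (L : Subset ((A × Γ) ^ω)) →
      L ∈ 𝔹 (𝒜 ⊗ 𝒢) → π₀[ L ] ∈ 𝔹 𝒜) →
    -- (P4)
    (∀ {A} (𝒜 : IsAlphabet A) (L : Subset (A ^ω)) → L ∈ 𝔹 𝒜 →
      ∃[ C ] C ∈ 𝔹 (𝒜 ⊗ two) × C ⊆ A ^ω×ℙ∞ ×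
        (∃[ F ] Closed (τ-C (A × Fin 2)) F × C ≐ F ∩ A ^ω×ℙ∞) ×
        L ≐ π₀[ C ]) →
    ∀ {A} (𝒜 : IsAlphabet A) → StrongChoquet (τ 𝒜)
theorem3p1 T P1 P2 P3 P4 𝒜 = Family.strongChoquet T P1 P2 P3 P4 𝒜
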